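{- There exists a finite tournament $T$ with minimum out-degree $\delta^+(T)=5$ that has exactly one vertex $x$ of out-degree $\delta^+(T)$, and this vertex $x$ is not a Seymour vertex of $T$ (and hence is not a strong Seymour vertex of $T$).
   Context: A tournament is an orientation of a complete graph. For a digraph $D$ with arc set $A(D)$ and a vertex $v$, $N_D^+(v)=\{y:(v,y)\in A(D)\}$ is the set of out-neighbors, $d_D^+(v)=|N_D^+(v)|$ is the out-degree, and $\delta^+(D)$ is the minimum out-degree over all vertices. The second out-neighborhood of $v$ is $$N^{++}_D(v)=\{z\in V(D)\setminus (N_D^+(v)\cup\{v\}) : (v,y),(y,z)\in A(D)\text{ for some }y\in N_D^+(v)\}.$$ A vertex $v$ is a Seymour vertex of $D$ if $|N^{++}_D(v)|\ge |N^+_D(v)|$. It is a strong Seymour vertex of $D$ if there is a complete matching from $N^+_D(v)$ to $N^{++}_D(v)$, i.e. a set of arcs of $D$ with tails in $N^+_D(v)$ and heads in $N^{++}_D(v)$, no two sharing an endpoint, such that every vertex of $N^+_D(v)$ is the tail of one of them. -}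

module Defs where

open import Data.Fin.Base using (Fin)
open import Data.Fin.Properties using (_≟_; any?)
open import Data.Fin.Subset using (Subset; _∈_; _∉_; ∣_∣)
open import Data.Fin.Subset.Properties using (_∈?_)
open import Data.List.Base using (List)
open import Data.List.Relation.Unary.All using (All)
open import Data.List.Relation.Unary.AllPairs using (AllPairs)
open import Data.List.Relation.Unary.Any using (Any)
open import Data.Nat.Base using (ℕ; suc; _≥_; _⊓_)
open import Data.Product.Base using (_×_; _,_; ∃; ∃-syntax)
open import Data.Vec.Base using (foldr₁; tabulate)
open import Level using (0ℓ)
open import Relation.Binary.Core using (Rel)
import Relation.Binary.Definitions as B
open import Relation.Binary.PropositionalEquality using (_≡_; _≢_)
open import Relation.Nullary.Decidable using (does; ¬?; _×-dec_)
open import Relation.Unary using (Pred; Decidable)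

-- ⟦ P? ⟧ is the set { i | P i }.
⟦_⟧ : ∀ {n} {P : Pred (Fin n) 0ℓ} → Decidable P → Subset n
⟦ P? ⟧ = tabulate (λ i → does (P? i))

record Digraph (n : ℕ) : Set₁ where
  infix 4 _⟶_ _⟶?_
  field
    _⟶_  : Rel (Fin n) 0ℓ
    _⟶?_ : B.Decidable _⟶_

  N⁺ : Fin n → Subset n
  N⁺ v = ⟦ (λ y → v ⟶? y) ⟧

  d⁺ : Fin n → ℕ
  d⁺ v = ∣ N⁺ v ∣

  IsSecondOutNeighbour : Fin n → Fin n → Set
  IsSecondOutNeighbour v z =
    z ∉ N⁺ v × z ≢ v × ∃[ y ] (y ∈ N⁺ v × v ⟶ y × y ⟶ z)

  isSecondOutNeighbour? : B.Decidable IsSecondOutNeighbour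
  isSecondOutNeighbour? v z =
    ¬? (z ∈? N⁺ v) ×-dec ¬? (z ≟ v) ×-dec
    any? (λ y → (y ∈? N⁺ v) ×-dec (v ⟶? y) ×-dec (y ⟶? z))

  N⁺⁺ : Fin n → Subset n
  N⁺⁺ v = ⟦ isSecondOutNeighbour? v ⟧

  -- Exactly one of u ⟶ v, u ≡ v, v ⟶ u holds: there are no loops, and each
  -- edge of the complete graph is oriented in exactly one direction.
  IsTournament : Set
  IsTournament = B.Trichotomous _≡_ _⟶_

  SeymourVertex : Fin n → Set
  SeymourVertex v = ∣ N⁺⁺ v ∣ ≥ ∣ N⁺ v ∣

  NoSharedEndpoint : Rel (Fin n × Fin n) 0ℓ
  NoSharedEndpoint (t , h) (t′ , h′) = t ≢ t′ × t ≢ h′ × h ≢ t′ × h ≢ h′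

  -- The set of arcs M is given as a list of (tail , head) pairs; `disjoint`
  -- excludes repeated entries.
  record IsCompleteMatching (X Y : Subset n) (M : List (Fin n × Fin n)) : Set where
    field
      arcs     : All (λ (t , h) → t ⟶ h × t ∈ X × h ∈ Y) M
      disjoint : AllPairs NoSharedEndpoint M
      covers   : ∀ {x} → x ∈ X → Any (λ (t , _) → t ≡ x) M

  StrongSeymourVertex : Fin n → Set
  StrongSeymourVertex v = ∃ (IsCompleteMatching (N⁺ v) (N⁺⁺ v))

-- The minimum is taken over all vertices, so the digraph must be nonempty.
δ⁺ : ∀ {n} → Digraph (suc n) → ℕ
δ⁺ D = foldr₁ _⊓_ (tabulate (Digraph.d⁺ D))

{-# OPTIONS --safe #-}

-- The counting bound 5·6 ≤ 10 + 5·|N⁺⁺(x)| on the out-degrees in N⁺(x), valid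
-- when the other vertices have out-degree at least 6, forces |N⁺⁺(x)| ≥ 4, and 4
-- is attained. Let V = {x} ∪ A ∪ B ∪ C with |A| = 5, |B| = 4, |C| = 5, and let
-- x → A → B → C → A and B ∪ C → x. Inside A take the rotational tournament, so
-- that every vertex of A has out-degree 2 + 4; inside B and C take transitive
-- tournaments, as those vertices already have out-degree 1 + 5 to other parts.
-- Then N⁺(x) = A and N⁺⁺(x) = B.
module Submission where

open import Defs
open import Data.Fin.Base using (Fin; zero; suc; toℕ)
open import Data.Fin.Properties using (_≟_; _<?_; all?)
open import Data.Fin.Subset
  using (Subset; inside; outside; ⊥; ⊤; ⁅_⁆; _∪_; ⋃; _∈_; ∣_∣)
open import Data.Fin.Subset.Properties
  using (_∈?_; ∪-identityˡ; ∣⊥∣≡0; ∣p∣≤∣x∷p∣; p⊆q⇒∣p∣≤∣q∣; p⊆p∪q; q⊆p∪q; x∈⁅x⁆;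
         x∈p∧x≢y⇒x∈p-y; x∈p⇒∣p-x∣<∣p∣)
open import Data.List.Base using (List; []; _∷_; length; map)
open import Data.List.Properties using (length-map)
open import Data.List.Relation.Unary.All as All using (All; []; _∷_)
import Data.List.Relation.Unary.All.Properties as All
open import Data.List.Relation.Unary.AllPairs as AllPairs using ([]; _∷_)
import Data.List.Relation.Unary.AllPairs.Properties as AllPairs
open import Data.List.Relation.Unary.Any using (Any; here; there)
open import Data.List.Relation.Unary.Unique.Propositional using (Unique)
open import Data.Nat.Base using (suc; _+_; _∸_; _%_; _≤_; s≤s; z≤n)
open import Data.Nat.Properties as ℕ using (module ≤-Reasoning)
open import Data.Product using (_×_; _,_; ∃-syntax; Σ-syntax; ∃!; proj₁; proj₂)
open import Data.Sum.Base using (_⊎_; inj₁; inj₂)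
open import Data.Vec.Base using (Vec; []; _∷_; _++_; lookup; tabulate)
open import Function.Base using (_∘_)
open import Relation.Binary.Core using (Rel)
open import Relation.Binary.Definitions
  using (Asymmetric; Trichotomous; tri<; tri≈; tri>)
open import Relation.Binary.PropositionalEquality using (_≡_; refl; ≢-sym)
open import Relation.Nullary using (¬_)
open import Relation.Nullary.Decidable using (from-yes; from-no; ¬?; _⊎-dec_; _→-dec_)

-- Splits trichotomy into two statements that are decidable on a finite digraph; irreflexivity is
-- asymmetry on the diagonal.
asym∧semiconnex⇒tri : ∀ {a r} {A : Set a} {_R_ : Rel A r} → Asymmetric _R_ →
                      (∀ u v → u R v ⊎ u ≡ v ⊎ v R u) → Trichotomous _≡_ _R_
asym∧semiconnex⇒tri asym conn u v with conn u v
... | inj₁ uRv         = tri< uRv (λ { refl → asym uRv uRv }) (asym uRv)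
... | inj₂ (inj₁ refl) = tri≈ (λ uRu → asym uRu uRu) refl (λ uRu → asym uRu uRu)
... | inj₂ (inj₂ vRu)  = tri> (asym vRu) (λ { refl → asym vRu vRu }) vRu

∣⁅x⁆∪p∣≤1+∣p∣ : ∀ {n} (x : Fin n) (p : Subset n) → ∣ ⁅ x ⁆ ∪ p ∣ ≤ suc ∣ p ∣
∣⁅x⁆∪p∣≤1+∣p∣ zero    (s ∷ p) rewrite ∪-identityˡ p = s≤s (∣p∣≤∣x∷p∣ s p)
∣⁅x⁆∪p∣≤1+∣p∣ (suc x) (outside ∷ p) = ∣⁅x⁆∪p∣≤1+∣p∣ x p
∣⁅x⁆∪p∣≤1+∣p∣ (suc x) (inside ∷ p)  = s≤s (∣⁅x⁆∪p∣≤1+∣p∣ x p)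

fromList : ∀ {n} → List (Fin n) → Subset n
fromList = ⋃ ∘ map ⁅_⁆

∣fromList∣≤length : ∀ {n} (xs : List (Fin n)) → ∣ fromList xs ∣ ≤ length xs
∣fromList∣≤length {n} []   = ℕ.≤-reflexive (∣⊥∣≡0 n)
∣fromList∣≤length (x ∷ xs) =
  ℕ.≤-trans (∣⁅x⁆∪p∣≤1+∣p∣ x (fromList xs)) (s≤s (∣fromList∣≤length xs))

-- Induction on the list: by distinctness the tail avoids the head `x`, so it lies in `p - x`, which
-- is strictly smaller than `p`.
unique⇒length≤∣p∣ : ∀ {n} {xs : List (Fin n)} {p : Subset n} →
                    All (_∈ p) xs → Unique xs → length xs ≤ ∣ p ∣
unique⇒length≤∣p∣ []            []           = z≤n
unique⇒length≤∣p∣ (x∈p ∷ xs∈p) (x∉xs ∷ uniq) = ℕ.≤-trans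
  (s≤s (unique⇒length≤∣p∣
    (All.zipWith (λ (y∈p , x≢y) → x∈p∧x≢y⇒x∈p-y y∈p (≢-sym x≢y)) (xs∈p , x∉xs)) uniq))
  (x∈p⇒∣p-x∣<∣p∣ x∈p)

module _ {n} (D : Digraph n) where
  open Digraph D

  -- Both sides are compared with the number of arcs: the tails cover `X`, and the heads are
  -- distinct elements of `Y`.
  matching⇒∣X∣≤∣Y∣ : ∀ {X Y M} → IsCompleteMatching X Y M → ∣ X ∣ ≤ ∣ Y ∣
  matching⇒∣X∣≤∣Y∣ {X} {Y} {M} matching = begin
    ∣ X ∣                         ≤⟨ p⊆q⇒∣p∣≤∣q∣ (λ x∈X → tail∈ (covers x∈X)) ⟩
    ∣ fromList (map proj₁ M) ∣    ≤⟨ ∣fromList∣≤length (map proj₁ M) ⟩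
    length (map proj₁ M)          ≡⟨ length-map proj₁ M ⟩
    length M                      ≡⟨ length-map proj₂ M ⟨
    length (map proj₂ M)          ≤⟨ unique⇒length≤∣p∣ heads∈Y uniqueHeads ⟩
    ∣ Y ∣                         ∎
    where
    open IsCompleteMatching matching
    open ≤-Reasoning

    tail∈ : ∀ {x M} → Any (λ (t , _) → t ≡ x) M → x ∈ fromList (map proj₁ M)
    tail∈ {x} (here refl) = p⊆p∪q _ (x∈⁅x⁆ x)
    tail∈ (there x∈M)     = q⊆p∪q _ _ (tail∈ x∈M)

    heads∈Y : All (_∈ Y) (map proj₂ M)
    heads∈Y = All.map⁺ (All.map (proj₂ ∘ proj₂) arcs)

    uniqueHeads : Unique (map proj₂ M)
    uniqueHeads = AllPairs.map⁺ (AllPairs.map (proj₂ ∘ proj₂ ∘ proj₂) disjoint)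

  strongSeymour⇒seymour : ∀ {v} → StrongSeymourVertex v → SeymourVertex v
  strongSeymour⇒seymour (_ , matching) = matching⇒∣X∣≤∣Y∣ matching

-- The blocks of each row are its intersections with {x}, A, B and C.
outNeighbours : Vec (Subset 15) 15
outNeighbours =
  (⊥ {1} ++ ⊤ {5} ++ ⊥ {4} ++ ⊥ {5}) ∷
  tabulate (λ i → ⊥ {1} ++ rotational i ++ ⊤ {4} ++ ⊥ {5}) ++
  tabulate (λ i → ⊤ {1} ++ ⊥ {5} ++ above {4} i ++ ⊤ {5}) ++
  tabulate (λ i → ⊤ {1} ++ ⊤ {5} ++ ⊥ {4} ++ above {5} i)
  where
  -- The arcs are `i → i + 1` and `i → i + 2` modulo 5; adding 5 first keeps the truncated
  -- subtraction exact.
  rotational : Fin 5 → Subset 5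
  rotational i = ⟦ (λ j → let d = (5 + toℕ j ∸ toℕ i) % 5 in d ℕ.≟ 1 ⊎-dec d ℕ.≟ 2) ⟧

  above : ∀ {n} → Fin n → Subset n
  above i = ⟦ (i <?_) ⟧

T₁₅ : Digraph 15
T₁₅ = record
  { _⟶_  = λ u v → v ∈ lookup outNeighbours u
  ; _⟶?_ = λ u v → v ∈? lookup outNeighbours u
  }

module _ where
  open Digraph T₁₅

  T₁₅-isTournament : IsTournament
  T₁₅-isTournament = asym∧semiconnex⇒tri (asym _ _) semiconnex
    where
    asym : ∀ u v → u ⟶ v → ¬ v ⟶ u
    asym = from-yes (all? λ u → all? λ v → (u ⟶? v) →-dec ¬? (v ⟶? u))

    semiconnex : ∀ u v → u ⟶ v ⊎ u ≡ v ⊎ v ⟶ u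
    semiconnex = from-yes (all? λ u → all? λ v → (u ⟶? v) ⊎-dec (u ≟ v) ⊎-dec (v ⟶? u))

  -- The out-degree is 6 throughout A, from 6 to 9 in B, and from 6 to 10 in C.
  uniqueMinimum : ∀ v → d⁺ v ≡ 5 → zero ≡ v
  uniqueMinimum = from-yes (all? λ v → (d⁺ v ℕ.≟ 5) →-dec (zero ≟ v))

  -- The refuted inequality evaluates to `5 ≤ 4`, the sizes of A and B.
  notSeymour : ¬ SeymourVertex zero
  notSeymour = from-no (∣ N⁺ zero ∣ ℕ.≤? ∣ N⁺⁺ zero ∣)

mainTheorem4 : ∃[ n ] Σ[ T ∈ Digraph (suc n) ] let open Digraph T in
    IsTournament × δ⁺ T ≡ 5 ×
    (Σ[ (x , _) ∈ ∃! _≡_ (λ v → d⁺ v ≡ δ⁺ T) ]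
    (¬ SeymourVertex x × ¬ StrongSeymourVertex x))
mainTheorem4 =
  -- `δ⁺ T₁₅` evaluates to 5, so `uniqueMinimum`, stated with the numeral, also fits the uniqueness
  -- claim.
  14 , T₁₅ , T₁₅-isTournament , refl ,
  (zero , refl , λ {v} → uniqueMinimum v) ,
  notSeymour , notSeymour ∘ strongSeymour⇒seymour T₁₅ {zero}
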